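{- $$26 \le b_5(2) \le 28.$$
   Context: For a positive integer $k$, $b_k(2)$ denotes the diagonal multicolor bipartite Ramsey number for the quadrilateral: the least positive integer $b$ such that any coloring of the edges of the complete bipartite graph $K_{b,b}$ with $k$ colors contains a monochromatic copy of $K_{2,2}=C_4$ (a 4-cycle all of whose edges have the same color). -}

module Defs where

open import Data.Nat using (ℕ; _≤_)
open import Data.Fin using (Fin)
open import Data.Product using (_×_; ∃-syntax)
open import Relation.Binary.PropositionalEquality using (_≡_; _≢_)

-- The two sides of K_{b,b} are two separate copies of Fin b, so its edges are
-- exactly the pairs (left vertex, right vertex).
EdgeColoring : (k b : ℕ) → Set
EdgeColoring k b = Fin b → Fin b → Fin k

-- A 4-cycle in K_{b,b} alternates sides, hence is given by two distinct left
-- vertices u, v and two distinct right vertices x, y, with edges ux, xv, vy, yu.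
HasMonochromaticC₄ : {k b : ℕ} → EdgeColoring k b → Set
HasMonochromaticC₄ {k} {b} χ =
  ∃[ c ] ∃[ u ] ∃[ v ] ∃[ x ] ∃[ y ]
    (u ≢ v × x ≢ y × χ u x ≡ c × χ v x ≡ c × χ v y ≡ c × χ u y ≡ c)

ForcesMonochromaticC₄ : (k b : ℕ) → Set
ForcesMonochromaticC₄ k b = (χ : EdgeColoring k b) → HasMonochromaticC₄ χ

-- "b = b_k(2)".
record IsBipartiteRamseyC₄ (k b : ℕ) : Set where
  field
    positive : 1 ≤ b
    forces   : ForcesMonochromaticC₄ k b
    least    : ∀ m → 1 ≤ m → ForcesMonochromaticC₄ k m → b ≤ m

{-# OPTIONS --safe #-}
module Submission where

-- Lower bound: over the field with p elements, the colour y + a x + b of the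
-- edge between the point (x , y) and the line (a , b) is C₄-free on p² + p²
-- vertices: a monochromatic quadrilateral gives (a − a')(x − x') = 0, while
-- a = a' forces b = b' and x = x' forces y = y'.
--
-- Upper bound: among the 784 edges of K_{28,28} some colour has at least
-- 157 = 6 · 17 + 5 · 11.  Deleting 11 left vertices of least degree keeps at
-- least 102 edges on the other 17: either all deleted degrees are at most 5, or
-- all kept degrees are at least 6.  If no two of these 17 neighbourhoods share two
-- vertices, then counting pairs with C(d , 2) ≥ 3 d − 6 over the 28 right
-- vertices gives 3 · 102 − 6 · 28 = 138 ≤ C(17 , 2) = 136, which is absurd.

open import Defs
import Algebra.Properties.Semiring.Sum as Sum
open import Data.Fin as Fin using (Fin; zero; suc; toℕ; fromℕ<; inject≤; punchIn; combine; remQuot; finToFun; funToFin)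
open import Data.Fin.Properties as Fin using (any?; all?)
open import Data.Integer as ℤ using (ℤ; +_; ∣_∣)
import Data.Integer.Divisibility.Signed as ℤ∣
import Data.Integer.Properties as ℤₚ
open import Data.Integer.Tactic.RingSolver using () renaming (solve-∀ to ℤ-solve-∀)
open import Data.Nat using (ℕ; zero; suc; _+_; _*_; _≤_; _<_; _≤?_; z≤n; s≤s; NonZero; _⊔_; _^_; _%_; _/_)
open import Data.Nat.Divisibility using (_∣_; >⇒∤)
open import Data.Nat.DivMod using (m≡m%n+[m/n]*n; m%n<n)
open import Data.Nat.Primality using (Prime; prime?; prime⇒nonZero; euclidsLemma)
open import Data.Nat.Properties
open import Data.Nat.Tactic.RingSolver using (solve-∀)
open import Data.Product using (_×_; _,_; ∃-syntax; proj₁; proj₂; uncurry)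
open import Data.Sum using (_⊎_; inj₁; inj₂; [_,_]′) renaming (map to map-⊎)
open import Function using (_∘_; id)
open import Function.Definitions using (Injective)
open import Relation.Binary.PropositionalEquality using (_≡_; _≢_; refl; sym; trans; cong; cong₂; subst; subst₂; module ≡-Reasoning)
open import Relation.Nullary using (¬_; Dec; yes; no; ¬?; contradiction; _×-dec_)
open import Relation.Nullary.Decidable using (map′; from-yes; decidable-stable)

open Sum +-*-semiring using (sum; sum-syntax; sum-cong-≗; sum-remove; sum-replicate-zero; ∑-distrib-+; ∑-comm; *-distribˡ-sum; *-distribʳ-sum)

-- Finite sums of natural numbers

sum-mono-≤ : ∀ {n} {f g : Fin n → ℕ} → (∀ i → f i ≤ g i) → sum f ≤ sum g
sum-mono-≤ {zero}  f≤g = z≤n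
sum-mono-≤ {suc n} f≤g = +-mono-≤ (f≤g zero) (sum-mono-≤ (f≤g ∘ suc))

sum-const : ∀ n c → ∑[ i < n ] c ≡ n * c
sum-const zero    c = refl
sum-const (suc n) c = cong (_+_ c) (sum-const n c)

sum≤n*c : ∀ {n c} {f : Fin n → ℕ} → (∀ i → f i ≤ c) → sum f ≤ n * c
sum≤n*c {n} {c} {f} f≤c = subst (sum f ≤_) (sum-const n c) (sum-mono-≤ f≤c)

n*c≤sum : ∀ {n c} {f : Fin n → ℕ} → (∀ i → c ≤ f i) → n * c ≤ sum f
n*c≤sum {n} {c} {f} c≤f = subst (_≤ sum f) (sum-const n c) (sum-mono-≤ c≤f)

sum-pigeonhole : ∀ {n} c (f : Fin n → ℕ) → n * c < sum f → ∃[ i ] c < f i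
sum-pigeonhole c f n*c<sum with any? (λ i → suc c ≤? f i)
... | yes large = large
... | no ¬large = contradiction (sum≤n*c λ i → ≮⇒≥ λ c<fi → ¬large (i , c<fi)) (<⇒≱ n*c<sum)

sum≤1 : ∀ {n} (f : Fin n → ℕ) → (∀ i → f i ≤ 1) →
        (∀ i j → i ≢ j → 0 < f i → ¬ 0 < f j) → sum f ≤ 1
sum≤1 {zero}  f f≤1 uniq = z≤n
sum≤1 {suc n} f f≤1 uniq with f zero in f0
... | zero = sum≤1 (f ∘ suc) (f≤1 ∘ suc) λ i j i≢j → uniq (suc i) (suc j) (i≢j ∘ Fin.suc-injective)
... | suc k = begin
  suc k + sum (f ∘ suc)  ≤⟨ +-mono-≤ (subst (_≤ 1) f0 (f≤1 zero)) (sum≤n*c rest≤0) ⟩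
  1 + n * 0              ≡⟨ cong suc (*-zeroʳ n) ⟩
  1                      ∎
  where
  open ≤-Reasoning
  rest≤0 : ∀ i → f (suc i) ≤ 0
  rest≤0 i = ≮⇒≥ λ 0<fi → uniq zero (suc i) (λ ()) (subst (0 <_) (sym f0) (s≤s z≤n)) 0<fi

-- Induction on the number `k` of deletions. An entry at most `s` is removed at a cost of at most
-- `s`, which the term `s * k` pays for. If there is none, every entry is at least `suc s` and any
-- deletion will do.
heavy-selection : ∀ s m k (f : Fin (k + m) → ℕ) → suc s * m + s * k ≤ sum f →
                  ∃[ g ] (Injective _≡_ _≡_ g × suc s * m ≤ ∑[ i < m ] f (g i))
heavy-selection s m zero f le = id , id , ≤-trans (m≤m+n _ _) le
heavy-selection s m (suc k) f le with any? (λ i → f i ≤? s)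
... | yes (i , fi≤s) = punchIn i ∘ g , g-inj ∘ Fin.punchIn-injective i _ _ , bound
  where
  open ≤-Reasoning
  remaining : suc s * m + s * k ≤ sum (f ∘ punchIn i)
  remaining = +-cancelˡ-≤ s _ _ (begin
    s + (suc s * m + s * k)     ≡⟨ rearrange s m k ⟩
    suc s * m + s * suc k       ≤⟨ le ⟩
    sum f                       ≡⟨ sum-remove f ⟩
    f i + sum (f ∘ punchIn i)   ≤⟨ +-monoˡ-≤ _ fi≤s ⟩
    s + sum (f ∘ punchIn i)     ∎)
    where
    rearrange : ∀ s m k → s + (suc s * m + s * k) ≡ suc s * m + s * suc k
    rearrange = solve-∀
  rec   = heavy-selection s m k (f ∘ punchIn i) remaining
  g     = proj₁ rec
  g-inj = proj₁ (proj₂ rec)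
  bound = proj₂ (proj₂ rec)
... | no all-large = suc ∘ g , g-inj ∘ Fin.suc-injective , bound
  where
  open ≤-Reasoning
  remaining : suc s * m + s * k ≤ sum (f ∘ suc)
  remaining = begin
    suc s * m + s * k      ≤⟨ +-monoʳ-≤ (suc s * m) (*-monoˡ-≤ k (n≤1+n s)) ⟩
    suc s * m + suc s * k  ≡⟨ rearrange s m k ⟩
    (k + m) * suc s        ≤⟨ n*c≤sum (λ i → ≰⇒> λ fi≤s → all-large (suc i , fi≤s)) ⟩
    sum (f ∘ suc)          ∎
    where
    rearrange : ∀ s m k → suc s * m + suc s * k ≡ (k + m) * suc s
    rearrange = solve-∀
  rec   = heavy-selection s m k (f ∘ suc) remaining
  g     = proj₁ rec
  g-inj = proj₁ (proj₂ rec)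
  bound = proj₂ (proj₂ rec)

-- (d − t)(d − t − 1) ≥ 0, since t and t + 1 are consecutive integers.
consecutive-roots : ∀ t d → suc (2 * t) * d ≤ d * d + t * suc t
consecutive-roots t d with ≤-total d t
... | inj₁ d≤t with e , refl ← m≤n⇒∃[o]m+o≡n d≤t =
  subst (suc (2 * (d + e)) * d ≤_) (identity d e) (m≤m+n _ (e * e + e))
  where
  identity : ∀ d e → suc (2 * (d + e)) * d + (e * e + e) ≡ d * d + (d + e) * suc (d + e)
  identity = solve-∀
... | inj₂ t≤d with e , refl ← m≤n⇒∃[o]m+o≡n t≤d = above e
  where
  above : ∀ e → suc (2 * t) * (t + e) ≤ (t + e) * (t + e) + t * suc t
  -- The case d = t is split off so that d - t - 1 is never truncated; for d = t + 1 + e the gap (d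
  -- - t)(d - t - 1) is e² + e.
  above zero    = ≤-reflexive (identity t)
    where
    identity : ∀ t → suc (2 * t) * (t + 0) ≡ (t + 0) * (t + 0) + t * suc t
    identity = solve-∀
  above (suc e) = subst (suc (2 * t) * (t + suc e) ≤_) (identity t e) (m≤m+n _ (e * e + e))
    where
    identity : ∀ t e → suc (2 * t) * (t + suc e) + (e * e + e) ≡ (t + suc e) * (t + suc e) + t * suc t
    identity = solve-∀

-- Idempotency says that `A` is a 0/1 matrix, in the form in which the diagonal terms of the pair
-- count collapse to row sums.
module _ {m n : ℕ} (A : Fin (suc m) → Fin n → ℕ)
         (idempotent : ∀ u x → A u x * A u x ≡ A u x)
         (common≤1 : ∀ u v → u ≢ v → ∑[ x < n ] (A u x * A v x) ≤ 1) where

  private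
    row : Fin (suc m) → ℕ
    row u = ∑[ x < n ] A u x

    column : Fin n → ℕ
    column x = ∑[ u < suc m ] A u x

    common : Fin (suc m) → Fin (suc m) → ℕ
    common u v = ∑[ x < n ] (A u x * A v x)

    -- The diagonal term `common u u` is `row u` by idempotency, and each of the `m` other rows adds
    -- at most 1.
    ∑common≤ : ∀ u → sum (common u) ≤ row u + m
    ∑common≤ u = begin
      sum (common u)                           ≡⟨ sum-remove (common u) ⟩
      common u u + sum (common u ∘ punchIn u)  ≤⟨ +-mono-≤ (≤-reflexive (sum-cong-≗ (idempotent u))) (sum≤n*c λ i → common≤1 u (punchIn u i) (Fin.punchInᵢ≢i u i ∘ sym)) ⟩
      row u + m * 1                            ≡⟨ cong (_+_ (row u)) (*-identityʳ m) ⟩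
      row u + m                                ∎
      where open ≤-Reasoning

    -- Both sides add up `A u x * A v x` over all u, v, x. Ordered pairs, u = v included, keep
    -- halves out of the count.
    ∑column² : ∑[ x < n ] (column x * column x) ≡ ∑[ u < suc m ] sum (common u)
    ∑column² = begin
      ∑[ x < n ] (column x * column x)                              ≡⟨ sum-cong-≗ (λ x → *-distribʳ-sum (column x) (λ u → A u x)) ⟩
      ∑[ x < n ] ∑[ u < suc m ] (A u x * column x)                  ≡⟨ ∑-comm (λ x u → A u x * column x) ⟩
      ∑[ u < suc m ] ∑[ x < n ] (A u x * column x)                  ≡⟨ sum-cong-≗ (λ u → sum-cong-≗ λ x → *-distribˡ-sum (A u x) (λ v → A v x)) ⟩
      ∑[ u < suc m ] ∑[ x < n ] ∑[ v < suc m ] (A u x * A v x)      ≡⟨ sum-cong-≗ (λ u → ∑-comm (λ x v → A u x * A v x)) ⟩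
      ∑[ u < suc m ] sum (common u)                                ∎
      where open ≡-Reasoning

  -- The pair count behind Reiman's bound, linearised at a free parameter t.
  zarankiewicz : ∀ t → 2 * t * ∑[ u < suc m ] ∑[ x < n ] A u x ≤ suc m * m + n * (t * suc t)
  -- On the left, the added `E` completes the coefficient 2t + 1 of `consecutive-roots`; on the
  -- right it is the total of the diagonal terms.
  zarankiewicz t = +-cancelˡ-≤ E _ _ (begin
    E + 2 * t * E                                        ≡⟨ cong (suc (2 * t) *_) (∑-comm A) ⟩
    suc (2 * t) * sum column                             ≡⟨ *-distribˡ-sum (suc (2 * t)) column ⟩
    ∑[ x < n ] (suc (2 * t) * column x)                  ≤⟨ sum-mono-≤ (consecutive-roots t ∘ column) ⟩
    ∑[ x < n ] (column x * column x + t * suc t)         ≡⟨ ∑-distrib-+ (λ x → column x * column x) (λ _ → t * suc t) ⟩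
    ∑[ x < n ] (column x * column x) + ∑[ x < n ] (t * suc t)
                                                         ≡⟨ cong₂ _+_ ∑column² (sum-const n (t * suc t)) ⟩
    ∑[ u < suc m ] sum (common u) + n * (t * suc t)     ≤⟨ +-monoˡ-≤ _ (sum-mono-≤ ∑common≤) ⟩
    ∑[ u < suc m ] (row u + m) + n * (t * suc t)         ≡⟨ cong (_+ n * (t * suc t)) (∑-distrib-+ row (λ _ → m)) ⟩
    E + ∑[ u < suc m ] m + n * (t * suc t)               ≡⟨ cong (λ z → E + z + n * (t * suc t)) (sum-const (suc m) m) ⟩
    E + suc m * m + n * (t * suc t)                      ≡⟨ +-assoc E _ _ ⟩
    E + (suc m * m + n * (t * suc t))                    ∎)
    where
    open ≤-Reasoning
    E = ∑[ u < suc m ] ∑[ x < n ] A u x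

-- Colourings of K_{b,b}

-- Kronecker delta by recursion, so that its properties follow by cases on constructors.
δ : ∀ {k} → Fin k → Fin k → ℕ
δ zero    zero    = 1
δ zero    (suc _) = 0
δ (suc _) zero    = 0
δ (suc i) (suc j) = δ i j

δ≤1 : ∀ {k} (i j : Fin k) → δ i j ≤ 1
δ≤1 zero    zero    = ≤-refl
δ≤1 zero    (suc _) = z≤n
δ≤1 (suc _) zero    = z≤n
δ≤1 (suc i) (suc j) = δ≤1 i j

δ-idempotent : ∀ {k} (i j : Fin k) → δ i j * δ i j ≡ δ i j
δ-idempotent zero    zero    = refl
δ-idempotent zero    (suc _) = refl
δ-idempotent (suc _) zero    = refl
δ-idempotent (suc i) (suc j) = δ-idempotent i j

0<δ⇒≡ : ∀ {k} (i j : Fin k) → 0 < δ i j → i ≡ j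
0<δ⇒≡ zero    zero    _   = refl
0<δ⇒≡ (suc i) (suc j) 0<δ = cong suc (0<δ⇒≡ i j 0<δ)

0<δ*δ⇒≡ : ∀ {k} (i j c : Fin k) → 0 < δ i c * δ j c → i ≡ c × j ≡ c
0<δ*δ⇒≡ i j c pos = 0<δ⇒≡ i c (m*n>0⇒m>0 (δ i c) pos) , 0<δ⇒≡ j c (m*n>0⇒m>0 (δ j c) (subst (0 <_) (*-comm (δ i c) _) pos))
  where
  m*n>0⇒m>0 : ∀ a {b} → 0 < a * b → 0 < a
  m*n>0⇒m>0 (suc a) _ = s≤s z≤n

∑δ≡1 : ∀ {k} (i : Fin k) → ∑[ c < k ] δ i c ≡ 1
∑δ≡1 {suc k} zero = cong suc (sum-replicate-zero k)
∑δ≡1 {suc k} (suc i) = ∑δ≡1 i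

colourClassSize : ∀ {k b} → EdgeColoring k b → Fin k → ℕ
colourClassSize {b = b} χ c = ∑[ u < b ] ∑[ x < b ] δ (χ u x) c

∑colourClassSize : ∀ {k b} (χ : EdgeColoring k b) → sum (colourClassSize χ) ≡ b * (b * 1)
∑colourClassSize {k} {b} χ = begin
  ∑[ c < k ] ∑[ u < b ] ∑[ x < b ] δ (χ u x) c  ≡⟨ ∑-comm (λ c u → ∑[ x < b ] δ (χ u x) c) ⟩
  ∑[ u < b ] ∑[ c < k ] ∑[ x < b ] δ (χ u x) c  ≡⟨ sum-cong-≗ (λ u → ∑-comm (λ c x → δ (χ u x) c)) ⟩
  ∑[ u < b ] ∑[ x < b ] ∑[ c < k ] δ (χ u x) c  ≡⟨ sum-cong-≗ (λ u → sum-cong-≗ λ x → ∑δ≡1 (χ u x)) ⟩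
  ∑[ u < b ] ∑[ x < b ] 1                       ≡⟨ sum-cong-≗ {b} (λ u → sum-const b 1) ⟩
  ∑[ u < b ] (b * 1)                            ≡⟨ sum-const b (b * 1) ⟩
  b * (b * 1)                                   ∎
  where open ≡-Reasoning

-- Two vertices joined to both u and v in colour c would close a quadrilateral.
C₄-free⇒common≤1 : ∀ {k b} {χ : EdgeColoring k b} → ¬ HasMonochromaticC₄ χ →
                    ∀ c u v → u ≢ v → ∑[ x < b ] (δ (χ u x) c * δ (χ v x) c) ≤ 1
C₄-free⇒common≤1 {χ = χ} C₄-free c u v u≢v =
  sum≤1 _ (λ x → *-mono-≤ (δ≤1 (χ u x) c) (δ≤1 (χ v x) c)) λ x y x≢y px py →
    let ux , vx = 0<δ*δ⇒≡ (χ u x) (χ v x) c px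
        uy , vy = 0<δ*δ⇒≡ (χ u y) (χ v y) c py
    in C₄-free (c , u , v , x , y , u≢v , x≢y , ux , vx , vy , uy)

-- `k` left vertices are deleted and `suc m` kept, with degree threshold `s`. The kept rows are
-- distinct by injectivity of the selection, so pairs of them still share at most one neighbour.
C₄-free-size-bound : ∀ {κ} s t m k {χ : EdgeColoring κ (k + suc m)} → ¬ HasMonochromaticC₄ χ →
                     ∀ c → suc s * suc m + s * k ≤ colourClassSize χ c →
                     2 * t * (suc s * suc m) ≤ suc m * m + (k + suc m) * (t * suc t)
C₄-free-size-bound s t m k {χ} C₄-free c large
  with g , g-inj , heavy ← heavy-selection s (suc m) k (λ u → ∑[ x < k + suc m ] δ (χ u x) c) large
  = ≤-trans (*-monoʳ-≤ (2 * t) heavy)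
      (zarankiewicz (λ u x → δ (χ (g u) x) c) (λ u x → δ-idempotent (χ (g u) x) c)
        (λ u v u≢v → C₄-free⇒common≤1 C₄-free c (g u) (g v) (u≢v ∘ g-inj)) t)

-- Decidability lets a refutation of C₄-freeness yield an actual quadrilateral.
hasMonochromaticC₄? : ∀ {k b} (χ : EdgeColoring k b) → Dec (HasMonochromaticC₄ χ)
hasMonochromaticC₄? χ =
  any? λ c → any? λ u → any? λ v → any? λ x → any? λ y →
    ¬? (u Fin.≟ v) ×-dec ¬? (x Fin.≟ y) ×-dec χ u x Fin.≟ c ×-dec χ v x Fin.≟ c
      ×-dec χ v y Fin.≟ c ×-dec χ u y Fin.≟ c

forces-28 : ForcesMonochromaticC₄ 5 28
forces-28 χ = decidable-stable (hasMonochromaticC₄? χ) λ C₄-free →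
  -- 784 > 5 · 156, so some colour has at least 157 edges.
  let c , large = sum-pigeonhole 156 (colourClassSize χ) (subst (780 <_) (sym (∑colourClassSize χ)) (from-yes (781 ≤? 784)))
  -- With t = 3 and 17 kept vertices the bound would read 6 · 102 = 612 ≤ 17 · 16 + 28 · 12 = 608.
  in <⇒≱ (from-yes (609 ≤? 612)) (C₄-free-size-bound 5 3 16 11 C₄-free c large)

-- The affine colouring

%-≡⇒∣ : ∀ m n p .{{_ : NonZero p}} → m % p ≡ n % p → + p ℤ∣.∣ + m ℤ.- + n
%-≡⇒∣ m n p m%p≡n%p = ℤ∣.divides (+ (m / p) ℤ.- + (n / p)) (begin
  + m ℤ.- + n                                                        ≡⟨ cong₂ ℤ._-_ (division m) (division n) ⟩
  (+ (m % p) ℤ.+ + (m / p) ℤ.* + p) ℤ.- (+ (n % p) ℤ.+ + (n / p) ℤ.* + p)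
                                                                     ≡⟨ cong (λ r → (+ r ℤ.+ + (m / p) ℤ.* + p) ℤ.- (+ (n % p) ℤ.+ + (n / p) ℤ.* + p)) m%p≡n%p ⟩
  (+ (n % p) ℤ.+ + (m / p) ℤ.* + p) ℤ.- (+ (n % p) ℤ.+ + (n / p) ℤ.* + p)
                                                                     ≡⟨ cancel (+ (n % p)) (+ (m / p)) (+ (n / p)) (+ p) ⟩
  (+ (m / p) ℤ.- + (n / p)) ℤ.* + p                                  ∎)
  where
  open ≡-Reasoning
  division : ∀ m → + m ≡ + (m % p) ℤ.+ + (m / p) ℤ.* + p
  division m = trans (cong +_ (m≡m%n+[m/n]*n m p)) (trans (ℤₚ.pos-+ (m % p) _) (cong (ℤ._+_ (+ (m % p))) (ℤₚ.pos-* (m / p) p)))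
  cancel : ∀ r q s p → (r ℤ.+ q ℤ.* p) ℤ.- (r ℤ.+ s ℤ.* p) ≡ (q ℤ.- s) ℤ.* p
  cancel = ℤ-solve-∀

toℤ : ∀ {n} → Fin n → ℤ
toℤ i = + toℕ i

-- Two numbers below p differ by less than p, so a difference divisible by p is zero.
∣-difference⇒≡ : ∀ {p} (i j : Fin p) → p ∣ ∣ toℤ i ℤ.- toℤ j ∣ → i ≡ j
∣-difference⇒≡ {p} i j p∣d with ∣ toℤ i ℤ.- toℤ j ∣ in eq
... | zero  = Fin.toℕ-injective (ℤₚ.+-injective (ℤₚ.i-j≡0⇒i≡j _ _ (ℤₚ.∣i∣≡0⇒i≡0 eq)))
... | suc d = contradiction p∣d (>⇒∤ (subst (_< p) eq small))
  where
  small : ∣ toℤ i ℤ.- toℤ j ∣ < p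
  small = ≤-<-trans (subst (λ z → ∣ z ∣ ≤ toℕ i ⊔ toℕ j) (sym (ℤₚ.m-n≡m⊖n (toℕ i) (toℕ j))) (ℤₚ.∣m⊝n∣≤m⊔n (toℕ i) (toℕ j)))
                    (⊔-lub (Fin.toℕ<n i) (Fin.toℕ<n j))

module _ {p : ℕ} (p-prime : Prime p) where

  private
    instance
      p≢0 : NonZero p
      p≢0 = prime⇒nonZero p-prime

    value : Fin p × Fin p → Fin p × Fin p → ℕ
    value (x , y) (a , b) = toℕ y + toℕ a * toℕ x + toℕ b

    -- Colours are computed in ℕ, where remainders live; differences are taken in this integer copy
    -- of `value`.
    valueℤ : Fin p × Fin p → Fin p × Fin p → ℤ
    valueℤ (x , y) (a , b) = toℤ y ℤ.+ toℤ a ℤ.* toℤ x ℤ.+ toℤ b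

    +value : ∀ P L → + value P L ≡ valueℤ P L
    +value (x , y) (a , b) = trans (ℤₚ.pos-+ (toℕ y + toℕ a * toℕ x) (toℕ b))
      (cong (ℤ._+ toℤ b) (trans (ℤₚ.pos-+ (toℕ y) _) (cong (ℤ._+_ (toℤ y)) (ℤₚ.pos-* (toℕ a) (toℕ x)))))

    colour : Fin p × Fin p → Fin p × Fin p → Fin p
    colour P L = fromℕ< (m%n<n (value P L) p)

    colour-≡⇒∣ : ∀ {c} P L P′ L′ → colour P L ≡ c → colour P′ L′ ≡ c → + p ℤ∣.∣ valueℤ P L ℤ.- valueℤ P′ L′
    colour-≡⇒∣ P L P′ L′ eq eq′ = subst₂ (λ s t → + p ℤ∣.∣ s ℤ.- t) (+value P L) (+value P′ L′)
      (%-≡⇒∣ _ _ p (trans (sym (Fin.toℕ-fromℕ< _)) (trans (cong toℕ (trans eq (sym eq′))) (Fin.toℕ-fromℕ< _))))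

    same-slope : ∀ {c} P a b b′ → colour P (a , b) ≡ c → colour P (a , b′) ≡ c → b ≡ b′
    same-slope (x , y) a b b′ eq eq′ = ∣-difference⇒≡ b b′ (ℤ∣.∣⇒∣ᵤ
      (subst (+ p ℤ∣.∣_) (identity (toℤ y) (toℤ a ℤ.* toℤ x) (toℤ b) (toℤ b′)) (colour-≡⇒∣ (x , y) (a , b) (x , y) (a , b′) eq eq′)))
      where
      identity : ∀ y z b b′ → (y ℤ.+ z ℤ.+ b) ℤ.- (y ℤ.+ z ℤ.+ b′) ≡ b ℤ.- b′
      identity = ℤ-solve-∀

    same-abscissa : ∀ {c} x y y′ L → colour (x , y) L ≡ c → colour (x , y′) L ≡ c → y ≡ y′
    same-abscissa x y y′ (a , b) eq eq′ = ∣-difference⇒≡ y y′ (ℤ∣.∣⇒∣ᵤ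
      (subst (+ p ℤ∣.∣_) (identity (toℤ y) (toℤ y′) (toℤ a ℤ.* toℤ x) (toℤ b)) (colour-≡⇒∣ (x , y) (a , b) (x , y′) (a , b) eq eq′)))
      where
      identity : ∀ y y′ z b → (y ℤ.+ z ℤ.+ b) ℤ.- (y′ ℤ.+ z ℤ.+ b) ≡ y ℤ.- y′
      identity = ℤ-solve-∀

    -- The alternating sum over the four corners cancels every term that depends on the point alone
    -- or the line alone; only the bilinear part a x survives.
    rectangle : ∀ {c} x y x′ y′ a b a′ b′ →
      colour (x , y) (a , b) ≡ c → colour (x′ , y′) (a , b) ≡ c →
      colour (x′ , y′) (a′ , b′) ≡ c → colour (x , y) (a′ , b′) ≡ c →
      + p ℤ∣.∣ (toℤ a ℤ.- toℤ a′) ℤ.* (toℤ x ℤ.- toℤ x′)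
    rectangle x y x′ y′ a b a′ b′ PL P′L P′L′ PL′ =
      subst (+ p ℤ∣.∣_) (identity (toℤ x) (toℤ y) (toℤ x′) (toℤ y′) (toℤ a) (toℤ b) (toℤ a′) (toℤ b′))
        (ℤ∣.∣m∣n⇒∣m-n (colour-≡⇒∣ (x , y) (a , b) (x′ , y′) (a , b) PL P′L)
                        (colour-≡⇒∣ (x , y) (a′ , b′) (x′ , y′) (a′ , b′) PL′ P′L′))
      where
      identity : ∀ x y x′ y′ a b a′ b′ →
        ((y ℤ.+ a ℤ.* x ℤ.+ b) ℤ.- (y′ ℤ.+ a ℤ.* x′ ℤ.+ b)) ℤ.- ((y ℤ.+ a′ ℤ.* x ℤ.+ b′) ℤ.- (y′ ℤ.+ a′ ℤ.* x′ ℤ.+ b′))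
          ≡ (a ℤ.- a′) ℤ.* (x ℤ.- x′)
      identity = ℤ-solve-∀

    -- Euclid's lemma: there are no zero divisors modulo a prime.
    equal-slope⊎equal-abscissa : ∀ (a a′ x x′ : Fin p) →
      + p ℤ∣.∣ (toℤ a ℤ.- toℤ a′) ℤ.* (toℤ x ℤ.- toℤ x′) → a ≡ a′ ⊎ x ≡ x′
    equal-slope⊎equal-abscissa a a′ x x′ p∣product =
      map-⊎ (∣-difference⇒≡ a a′) (∣-difference⇒≡ x x′)
        (euclidsLemma ∣ toℤ a ℤ.- toℤ a′ ∣ ∣ toℤ x ℤ.- toℤ x′ ∣ p-prime
          (subst (p ∣_) (ℤₚ.abs-* (toℤ a ℤ.- toℤ a′) (toℤ x ℤ.- toℤ x′)) (ℤ∣.∣⇒∣ᵤ p∣product)))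

    colour-C₄-free : ∀ {c} P P′ L L′ → P ≢ P′ → L ≢ L′ →
      colour P L ≡ c → colour P′ L ≡ c → colour P′ L′ ≡ c → ¬ colour P L′ ≡ c
    colour-C₄-free (x , y) (x′ , y′) (a , b) (a′ , b′) P≢P′ L≢L′ PL P′L P′L′ PL′ =
      [ (λ { refl → L≢L′ (cong (a ,_) (same-slope (x , y) a b b′ PL PL′)) })
      , (λ { refl → P≢P′ (cong (x ,_) (same-abscissa x y y′ (a , b) PL P′L)) })
      ]′ (equal-slope⊎equal-abscissa a a′ x x′ (rectangle x y x′ y′ a b a′ b′ PL P′L P′L′ PL′))

    remQuot-injective : ∀ {u v : Fin (p * p)} → remQuot {p} p u ≡ remQuot p v → u ≡ v
    remQuot-injective {u} {v} eq =
      trans (sym (Fin.combine-remQuot {p} p u)) (trans (cong (uncurry combine) eq) (Fin.combine-remQuot {p} p v))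

  -- Writing indices below p² in base p identifies left vertices with points and right vertices with
  -- lines.
  ¬forces-p² : ¬ ForcesMonochromaticC₄ p (p * p)
  ¬forces-p² forces
    with c , u , v , x , y , u≢v , x≢y , ux , vx , vy , uy ← forces (λ u x → colour (remQuot {p} p u) (remQuot {p} p x))
    = colour-C₄-free (remQuot p u) (remQuot p v) (remQuot p x) (remQuot p y)
        (u≢v ∘ remQuot-injective) (x≢y ∘ remQuot-injective) ux vx vy uy

-- The least forcing size

-- A quadrilateral already appears among the first m vertices of each side.
forces-mono : ∀ {k m n} → m ≤ n → ForcesMonochromaticC₄ k m → ForcesMonochromaticC₄ k n
forces-mono m≤n forces χ
  with c , u , v , x , y , u≢v , x≢y , edges ← forces (λ u x → χ (inject≤ u m≤n) (inject≤ x m≤n))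
  = c , inject≤ u m≤n , inject≤ v m≤n , inject≤ x m≤n , inject≤ y m≤n ,
    u≢v ∘ Fin.inject≤-injective m≤n m≤n u v , x≢y ∘ Fin.inject≤-injective m≤n m≤n x y , edges

-- Decoding an encoded colouring returns it only pointwise, so the property has to pass along
-- pointwise equality.
hasMonochromaticC₄-resp : ∀ {k b} {χ ψ : EdgeColoring k b} → (∀ u x → χ u x ≡ ψ u x) →
                          HasMonochromaticC₄ χ → HasMonochromaticC₄ ψ
hasMonochromaticC₄-resp χ≡ψ (c , u , v , x , y , u≢v , x≢y , ux , vx , vy , uy) =
  c , u , v , x , y , u≢v , x≢y ,
  trans (sym (χ≡ψ u x)) ux , trans (sym (χ≡ψ v x)) vx , trans (sym (χ≡ψ v y)) vy , trans (sym (χ≡ψ u y)) uy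

-- There are `(k ^ b) ^ b` colourings; numbering them turns the quantifier over functions into a
-- finite one.
forces? : ∀ k b → Dec (ForcesMonochromaticC₄ k b)
forces? k b = map′ (λ all χ → hasMonochromaticC₄-resp (decode-encode χ) (all (encode χ)))
                   (λ forces i → forces (decode i))
                   (all? (hasMonochromaticC₄? ∘ decode))
  where
  decode : Fin ((k ^ b) ^ b) → EdgeColoring k b
  decode i u = finToFun (finToFun i u)
  encode : EdgeColoring k b → Fin ((k ^ b) ^ b)
  encode χ = funToFin (funToFin ∘ χ)
  decode-encode : ∀ χ u x → decode (encode χ) u x ≡ χ u x
  decode-encode χ u x = trans (cong (λ i → finToFun i x) (Fin.finToFun-funToFin (funToFin ∘ χ) u))
                              (Fin.finToFun-funToFin (χ u) x)

-- Upward search from `lo`: when `P lo` fails, the lower bound rises by one and the distance `d` to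
-- the known solution drops by one.
least-between : ∀ {P : ℕ → Set} → (∀ m → Dec (P m)) → ∀ d lo → (∀ m → P m → lo ≤ m) → P (d + lo) →
                ∃[ b ] (P b × (∀ m → P m → b ≤ m) × lo ≤ b × b ≤ d + lo)
least-between P? zero    lo below p = lo , p , below , ≤-refl , ≤-refl
least-between {P} P? (suc d) lo below p with P? lo
... | yes q = lo , q , below , ≤-refl , m≤n+m lo (suc d)
... | no ¬q
  with b , Pb , least , lo<b , b≤ ← least-between P? d (suc lo)
         (λ m Pm → ≤∧≢⇒< (below m Pm) λ { refl → ¬q Pm }) (subst P (sym (+-suc d lo)) p)
  = b , Pb , least , <⇒≤ lo<b , subst (b ≤_) (+-suc d lo) b≤

isBipartiteRamseyC₄-between : ∀ k d lo → 1 ≤ lo → (∀ m → ForcesMonochromaticC₄ k m → lo ≤ m) →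
                              ForcesMonochromaticC₄ k (d + lo) →
                              ∃[ b ] (IsBipartiteRamseyC₄ k b × lo ≤ b × b ≤ d + lo)
isBipartiteRamseyC₄-between k d lo 1≤lo below above
  with b , forces , least , lo≤b , b≤ ← least-between (forces? k) d lo below above
  = b , record { positive = ≤-trans 1≤lo lo≤b ; forces = forces ; least = λ m _ → least m } , lo≤b , b≤

theorem10 : ∃[ b ] (IsBipartiteRamseyC₄ 5 b × 26 ≤ b × b ≤ 28)
theorem10 = isBipartiteRamseyC₄-between 5 2 26 (s≤s z≤n)
  -- A forcing m ≤ 25 would make 25 = 5 · 5 forcing too, against the affine colouring for p = 5.
  (λ m forces → ≰⇒> λ m≤25 → ¬forces-p² (from-yes (prime? 5)) (forces-mono m≤25 forces))
  forces-28
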